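{- Let $K\ge 1$ and $w\ge 1$ be constant integers, let $\varepsilon\in(0,1/4)$ be an arbitrary constant, and fix a constant $\delta<1-(1/2)^K$. For each integer $\ell\ge1$ let $\mathcal{I}(\ell)=\{y_1,\ldots,y_K\}\cup\{x_1,\ldots,x_\ell\}$ be a set of $K+\ell$ distinct items. Let $t(\cdot)$ be any function with positive integer values such that $t(x)\in o(\ln x)$ as $x\to\infty$. Then, for all large enough $\ell$, there exists a dataset $\mathcal{D}^*$ of transactions over $\mathcal{I}(\ell)$ such that, for a random sample $\mathcal{S}$ of $t(\ell)$ transactions drawn uniformly with replacement from $\mathcal{D}^*$, the probability that $\mathrm{TOPK}(\mathcal{S},\mathcal{I}(\ell),K,w)$ is an $\varepsilon$-approximation to $\mathrm{TOPK}(\mathcal{D}^*,\mathcal{I}(\ell),K,w)$ is less than $1-\delta$.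
   Context: A dataset (or sample) is a finite nonempty multiset/sequence of transactions, each transaction being a subset of the item set $\mathcal{I}$. $U(\mathcal{I},w)$ is the family of all itemsets $x\subseteq\mathcal{I}$ with $1\le|x|\le w$. For a dataset or sample $\mathcal{T}$, $f_{\mathcal{T}}(x)$ is the fraction of transactions of $\mathcal{T}$ (counted with multiplicity) that contain $x$ as a subset, and $f_{\mathcal{T}}^{(K)}$ is the frequency of the $K$-th itemset when the itemsets of $U(\mathcal{I},w)$ are sorted by decreasing $f_{\mathcal{T}}$ (ties broken arbitrarily). Define $$\mathrm{TOPK}(\mathcal{T},\mathcal{I},K,w)=\{(x,f_{\mathcal{T}}(x)) : x\in U(\mathcal{I},w),\ f_{\mathcal{T}}(x)\ge f_{\mathcal{T}}^{(K)}\}.$$ For $\varepsilon\in(0,1)$, an $\varepsilon$-approximation to $\mathrm{TOPK}(\mathcal{D},\mathcal{I},K,w)$ is a set $W$ of $K$ or more ordered pairs $(x,f)$ with $x\in U(\mathcal{I},w)$, $f\in[0,1]$, such that: (P1) for each $(x,f)\in W$, $f_{\mathcal{D}}(x)\ge f_{\mathcal{D}}^{(K)}-\varepsilon$; (P2) for each $x\in U(\mathcal{I},w)$ that does not occur as first component of a pair in $W$, $f_{\mathcal{D}}(x)<f_{\mathcal{D}}^{(K)}+\varepsilon$; (P3) for each $(x,f)\in W$, $|f-f_{\mathcal{D}}(x)|\le\varepsilon$. -}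

module Defs where

open import Data.Nat as ℕ using (ℕ; zero; suc; z≤n; s≤s)
import Data.Nat.Properties as ℕ
open import Data.Integer as ℤ using (+_)
import Data.Integer.Properties as ℤ
open import Data.Rational
import Data.Rational.Unnormalised as ℚᵘ
import Data.Rational.Unnormalised.Properties as ℚᵘ
open import Data.Rational.Properties
open import Data.Rational.Solver using (module +-*-Solver)
open import Data.Fin using (Fin)
open import Data.Fin.Subset using (Subset; inside; outside; _⊆_)
  renaming (∣_∣ to size)
open import Data.Fin.Subset.Properties using (_⊆?_)
open import Data.List as List using (List; []; _∷_; length; filter; drop; head; allFin)
import Data.List.Sort as Sort
open import Data.Maybe using (maybe′)
open import Data.Vec as Vec using (Vec; count; lookup)
open import Data.Product using (Σ; ∃-syntax; _×_; _,_; proj₁; proj₂)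
open import Data.Sum using (inj₁; inj₂)
open import Function using (_⇔_; mk⇔)
open import Level using (0ℓ)
open import Relation.Binary using (DecTotalOrder)
import Relation.Binary.Construct.Flip.EqAndOrd as Flip
import Relation.Binary.Construct.On as On
import Relation.Binary.Reasoning.Setoid as ≃-Reasoning
open import Relation.Binary.PropositionalEquality
open import Relation.Nullary using (¬_)
open import Relation.Nullary.Decidable using (_×-dec_)
open import Relation.Unary using (Pred; Decidable)
import Data.List.Relation.Binary.Sublist.Propositional as Sublist
import Data.List.Relation.Binary.Sublist.Propositional.Properties as Sublist

IsCauchy : (ℕ → ℚ) → Set
IsCauchy s = ∀ e → 0ℚ < e →
  ∃[ N ] ∀ m n → N ℕ.≤ m → N ℕ.≤ n → ∣ s m - s n ∣ ≤ e

-- Real numbers are Cauchy sequences of rationals, compared by _≃ᴿ_ below.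
record ℝ : Set where
  constructor mkℝ
  field
    seq    : ℕ → ℚ
    cauchy : IsCauchy seq

open ℝ public

infix 4 _≤ᴿ_ _<ᴿ_ _≃ᴿ_

_≤ᴿ_ : ℝ → ℝ → Set
x ≤ᴿ y = ∀ e → 0ℚ < e → ∃[ N ] ∀ n → N ℕ.≤ n → seq x n ≤ seq y n + e

_<ᴿ_ : ℝ → ℝ → Set
x <ᴿ y = ∃[ e ] 0ℚ < e × ∃[ N ] ∀ n → N ℕ.≤ n → seq x n + e ≤ seq y n

_≃ᴿ_ : ℝ → ℝ → Set
x ≃ᴿ y = ∀ e → 0ℚ < e → ∃[ N ] ∀ n → N ℕ.≤ n → ∣ seq x n - seq y n ∣ ≤ e

module RealLemmas where
  open +-*-Solver

  halves : ∀ e → ½ * e + ½ * e ≡ e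
  halves e = trans (sym (*-distribʳ-+ e ½ ½)) (*-identityˡ e)

  mult-pos : ∀ {p q} → 0ℚ < p → 0ℚ < q → 0ℚ < p * q
  mult-pos {p} {q} 0<p 0<q = positive⁻¹ (p * q)
    {{pos*pos⇒pos p {{positive 0<p}} q {{positive 0<q}}}}

  half-pos : ∀ {e} → 0ℚ < e → 0ℚ < ½ * e
  half-pos = mult-pos (positive⁻¹ ½)

  q≤∣q∣ : ∀ q → q ≤ ∣ q ∣
  q≤∣q∣ q with ≤-total 0ℚ q
  ... | inj₁ 0≤q = ≤-reflexive (sym (0≤p⇒∣p∣≡p 0≤q))
  ... | inj₂ q≤0 = ≤-trans q≤0 (0≤∣p∣ q)

  ∣q∣-bound : ∀ {q e} → q ≤ e → - q ≤ e → ∣ q ∣ ≤ e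
  ∣q∣-bound {q} q≤e -q≤e with ∣p∣≡p∨∣p∣≡-p q
  ... | inj₁ eq = ≤-trans (≤-reflexive eq) q≤e
  ... | inj₂ eq = ≤-trans (≤-reflexive eq) -q≤e

  ∣p-q∣-bound : ∀ {p q e} → p ≤ q + e → q ≤ p + e → ∣ p - q ∣ ≤ e
  ∣p-q∣-bound {p} {q} {e} p≤ q≤ = ∣q∣-bound
    (≤-trans (+-monoˡ-≤ (- q) p≤)
      (≤-reflexive (solve 2 (λ q e → q :+ e :- q := e) refl q e)))
    (≤-trans
      (≤-reflexive (solve 2 (λ p q → :- (p :- q) := q :- p) refl p q))
      (≤-trans (+-monoˡ-≤ (- p) q≤)
        (≤-reflexive (solve 2 (λ p e → p :+ e :- p := e) refl p e))))

  p≤q+∣p-q∣ : ∀ p q → p ≤ q + ∣ p - q ∣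
  p≤q+∣p-q∣ p q = ≤-trans
    (≤-reflexive (solve 2 (λ p q → p := q :+ (p :- q)) refl p q))
    (+-monoʳ-≤ q (q≤∣q∣ (p - q)))

  ∣p-q∣≡∣q-p∣ : ∀ p q → ∣ p - q ∣ ≡ ∣ q - p ∣
  ∣p-q∣≡∣q-p∣ p q = trans (sym (∣-p∣≡∣p∣ (p - q)))
    (cong ∣_∣ (solve 2 (λ p q → :- (p :- q) := q :- p) refl p q))

  ∣p∣≤∣q∣+∣p-q∣ : ∀ p q → ∣ p ∣ ≤ ∣ q ∣ + ∣ p - q ∣
  ∣p∣≤∣q∣+∣p-q∣ p q = ≤-trans
    (≤-reflexive (cong ∣_∣ (solve 2 (λ p q → p := q :+ (p :- q)) refl p q)))
    (∣p+q∣≤∣p∣+∣q∣ q (p - q))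

  const-cauchy : ∀ q → IsCauchy (λ _ → q)
  const-cauchy q e 0<e = 0 , λ _ _ _ _ →
    subst (λ z → ∣ z ∣ ≤ e) (sym (+-inverseʳ q)) (<⇒≤ 0<e)

  +-cauchy : ∀ x y → IsCauchy (λ n → seq x n + seq y n)
  +-cauchy x y e 0<e with cauchy x (½ * e) (half-pos 0<e) | cauchy y (½ * e) (half-pos 0<e)
  ... | N , hx | M , hy = N ℕ.⊔ M , λ m n m≥ n≥ → begin
    ∣ seq x m + seq y m - (seq x n + seq y n) ∣
      ≡⟨ cong ∣_∣ (solve 4 (λ a b c d → a :+ b :- (c :+ d) := (a :- c) :+ (b :- d)) refl
           (seq x m) (seq y m) (seq x n) (seq y n)) ⟩
    ∣ (seq x m - seq x n) + (seq y m - seq y n) ∣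
      ≤⟨ ∣p+q∣≤∣p∣+∣q∣ (seq x m - seq x n) (seq y m - seq y n) ⟩
    ∣ seq x m - seq x n ∣ + ∣ seq y m - seq y n ∣
      ≤⟨ +-mono-≤ (hx m n (ℕ.m⊔n≤o⇒m≤o N M m≥) (ℕ.m⊔n≤o⇒m≤o N M n≥))
                  (hy m n (ℕ.m⊔n≤o⇒n≤o N M m≥) (ℕ.m⊔n≤o⇒n≤o N M n≥)) ⟩
    ½ * e + ½ * e
      ≡⟨ halves e ⟩
    e ∎
    where open ≤-Reasoning

  neg-cauchy : ∀ x → IsCauchy (λ n → - seq x n)
  neg-cauchy x e 0<e with cauchy x e 0<e
  ... | N , h = N , λ m n m≥ n≥ → subst (_≤ e)
    (trans (sym (∣-p∣≡∣p∣ (seq x m - seq x n)))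
      (cong ∣_∣ (solve 2 (λ a b → :- (a :- b) := :- a :- (:- b)) refl (seq x m) (seq x n))))
    (h m n m≥ n≥)

  abs-cauchy : ∀ x → IsCauchy (λ n → ∣ seq x n ∣)
  abs-cauchy x e 0<e with cauchy x e 0<e
  ... | N , h = N , λ m n m≥ n≥ → ∣p-q∣-bound
    (≤-trans (∣p∣≤∣q∣+∣p-q∣ (seq x m) (seq x n)) (+-monoʳ-≤ ∣ seq x n ∣ (h m n m≥ n≥)))
    (≤-trans (∣p∣≤∣q∣+∣p-q∣ (seq x n) (seq x m)) (+-monoʳ-≤ ∣ seq x m ∣ (h n m n≥ m≥)))

  eventual-bound : ∀ x → ∃[ B ] 0ℚ < B × ∃[ N ] ∀ n → N ℕ.≤ n → ∣ seq x n ∣ ≤ B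
  eventual-bound x with cauchy x 1ℚ (positive⁻¹ 1ℚ)
  ... | N , h = ∣ seq x N ∣ + 1ℚ
              , +-mono-≤-< (0≤∣p∣ (seq x N)) (positive⁻¹ 1ℚ)
              , N
              , λ n n≥ → ≤-trans (∣p∣≤∣q∣+∣p-q∣ (seq x n) (seq x N))
                  (+-monoʳ-≤ ∣ seq x N ∣ (h n N n≥ ℕ.≤-refl))

  scale-down : ∀ {B e} → 0ℚ < B → 0ℚ < e → ∃[ d ] 0ℚ < d × B * d ≡ ½ * e
  scale-down {B} {e} 0<B 0<e = B⁻¹ * (½ * e)
    , mult-pos (positive⁻¹ B⁻¹ {{1/pos⇒pos B {{positive 0<B}}}}) (half-pos 0<e)
    , (begin
        B * (B⁻¹ * (½ * e)) ≡⟨ *-assoc B B⁻¹ (½ * e) ⟨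
        B * B⁻¹ * (½ * e)   ≡⟨ cong (_* (½ * e)) (*-inverseʳ B {{nz}}) ⟩
        1ℚ * (½ * e)        ≡⟨ *-identityˡ (½ * e) ⟩
        ½ * e               ∎)
    where
    open ≡-Reasoning
    nz  = pos⇒nonZero B {{positive 0<B}}
    B⁻¹ = (1/ B) {{nz}}

  *-mono-≤-nonNeg : ∀ {a b c d} → 0ℚ ≤ b → 0ℚ ≤ c → a ≤ b → c ≤ d → a * c ≤ b * d
  *-mono-≤-nonNeg {a} {b} {c} {d} 0≤b 0≤c a≤b c≤d = ≤-trans
    (*-monoʳ-≤-nonNeg c {{nonNegative 0≤c}} a≤b)
    (*-monoˡ-≤-nonNeg b {{nonNegative 0≤b}} c≤d)

  ∣ad-bc∣-bound : ∀ a d b c {B C p q} → 0ℚ ≤ B → 0ℚ ≤ C → ∣ a ∣ ≤ B → ∣ c ∣ ≤ C →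
                  ∣ d - c ∣ ≤ p → ∣ a - b ∣ ≤ q → ∣ a * d - b * c ∣ ≤ B * p + C * q
  ∣ad-bc∣-bound a d b c {B} {C} {p} {q} 0≤B 0≤C a≤ c≤ dc≤ ab≤ = begin
    ∣ a * d - b * c ∣
      ≡⟨ cong ∣_∣ (solve 4 (λ a d b c → a :* d :- b :* c := a :* (d :- c) :+ c :* (a :- b))
           refl a d b c) ⟩
    ∣ a * (d - c) + c * (a - b) ∣
      ≤⟨ ∣p+q∣≤∣p∣+∣q∣ (a * (d - c)) (c * (a - b)) ⟩
    ∣ a * (d - c) ∣ + ∣ c * (a - b) ∣
      ≡⟨ cong₂ _+_ (∣p*q∣≡∣p∣*∣q∣ a (d - c)) (∣p*q∣≡∣p∣*∣q∣ c (a - b)) ⟩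
    ∣ a ∣ * ∣ d - c ∣ + ∣ c ∣ * ∣ a - b ∣
      ≤⟨ +-mono-≤ (*-mono-≤-nonNeg 0≤B (0≤∣p∣ (d - c)) a≤ dc≤)
                  (*-mono-≤-nonNeg 0≤C (0≤∣p∣ (a - b)) c≤ ab≤) ⟩
    B * p + C * q ∎
    where open ≤-Reasoning

  *-cauchy : ∀ x y → IsCauchy (λ n → seq x n * seq y n)
  *-cauchy x y e 0<e =
    let B , 0<B , N₁ , hB = eventual-bound x
        C , 0<C , N₂ , hC = eventual-bound y
        p , 0<p , Bp = scale-down 0<B 0<e
        q , 0<q , Cq = scale-down 0<C 0<e
        N₃ , hy = cauchy y p 0<p
        N₄ , hx = cauchy x q 0<q
        N₁₂ = N₁ ℕ.⊔ N₂ ; N₃₄ = N₃ ℕ.⊔ N₄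
    in N₁₂ ℕ.⊔ N₃₄ , λ m n m≥ n≥ →
      let m≥₁ = ℕ.m⊔n≤o⇒m≤o N₁ N₂ (ℕ.m⊔n≤o⇒m≤o N₁₂ N₃₄ m≥)
          n≥₂ = ℕ.m⊔n≤o⇒n≤o N₁ N₂ (ℕ.m⊔n≤o⇒m≤o N₁₂ N₃₄ n≥)
          m≥₃₄ = ℕ.m⊔n≤o⇒n≤o N₁₂ N₃₄ m≥
          n≥₃₄ = ℕ.m⊔n≤o⇒n≤o N₁₂ N₃₄ n≥
      in ≤-trans
        (∣ad-bc∣-bound (seq x m) (seq y m) (seq x n) (seq y n)
          (<⇒≤ 0<B) (<⇒≤ 0<C) (hB m m≥₁) (hC n n≥₂)
          (hy m n (ℕ.m⊔n≤o⇒m≤o N₃ N₄ m≥₃₄) (ℕ.m⊔n≤o⇒m≤o N₃ N₄ n≥₃₄))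
          (hx m n (ℕ.m⊔n≤o⇒n≤o N₃ N₄ m≥₃₄) (ℕ.m⊔n≤o⇒n≤o N₃ N₄ n≥₃₄)))
        (≤-reflexive (trans (cong₂ _+_ Bp Cq) (halves e)))

open RealLemmas using (const-cauchy; +-cauchy; neg-cauchy; abs-cauchy; *-cauchy)

ι : ℚ → ℝ
ι q = mkℝ (λ _ → q) (const-cauchy q)

infixl 6 _+ᴿ_ _-ᴿ_
infixl 7 _*ᴿ_

_+ᴿ_ : ℝ → ℝ → ℝ
x +ᴿ y = mkℝ (λ n → seq x n + seq y n) (+-cauchy x y)

-ᴿ_ : ℝ → ℝ
-ᴿ x = mkℝ (λ n → - seq x n) (neg-cauchy x)

_-ᴿ_ : ℝ → ℝ → ℝ
x -ᴿ y = x +ᴿ (-ᴿ y)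

_*ᴿ_ : ℝ → ℝ → ℝ
x *ᴿ y = mkℝ (λ n → seq x n * seq y n) (*-cauchy x y)

∣_∣ᴿ : ℝ → ℝ
∣ x ∣ᴿ = mkℝ (λ n → ∣ seq x n ∣) (abs-cauchy x)

ℕ→ℝ : ℕ → ℝ
ℕ→ℝ n = ι (+ n / 1)

sum : (ℕ → ℚ) → ℕ → ℚ
sum f zero    = 0ℚ
sum f (suc n) = sum f n + f n

-- The natural logarithm of an integer n ≥ 1 is ∫₁ⁿ ds/s.
-- With M = m + 1, the right-endpoint Riemann sum of 1/s over [1 , n] with mesh
-- 1/M is Σ (1/M) · 1/(1 + (i+1)/M) = Σ 1/(M + i + 1), for i < (n ∸ 1) * M.
lnSum : ℕ → ℕ → ℚ
lnSum n m = sum (λ i → + 1 / suc (m ℕ.+ suc i)) ((n ℕ.∸ 1) ℕ.* suc m)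

module LnLemmas where
  open RealLemmas using (∣p-q∣-bound)
  open +-*-Solver

  r : ℕ → ℚ
  r k = + 1 / suc k

  rᵘ : ∀ k → toℚᵘ (r k) ℚᵘ.≃ ℚᵘ.mkℚᵘ (+ 1) k
  rᵘ k = toℚᵘ-fromℚᵘ (ℚᵘ.mkℚᵘ (+ 1) k)

  r-antimono : ∀ {a b} → a ℕ.≤ b → r b ≤ r a
  r-antimono {a} {b} a≤b = toℚᵘ-cancel-≤ (begin
    toℚᵘ (r b)         ≃⟨ rᵘ b ⟩
    ℚᵘ.mkℚᵘ (+ 1) b    ≤⟨ ℚᵘ.*≤* (ℤ.*-monoˡ-≤-nonNeg (+ 1) (ℤ.+≤+ (s≤s a≤b))) ⟩
    ℚᵘ.mkℚᵘ (+ 1) a    ≃⟨ rᵘ a ⟨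
    toℚᵘ (r a)         ∎)
    where open ℚᵘ.≤-Reasoning

  0≤r : ∀ k → 0ℚ ≤ r k
  0≤r k = nonNegative⁻¹ (r k) {{normalize-nonNeg 1 (suc k)}}

  r-scale : ∀ k a → (+ suc k / 1) * r (k ℕ.+ a ℕ.* suc k) ≡ r a
  r-scale k a = toℚᵘ-injective (begin
    toℚᵘ ((+ suc k / 1) * r (k ℕ.+ a ℕ.* suc k))
      ≈⟨ toℚᵘ-homo-* (+ suc k / 1) (r (k ℕ.+ a ℕ.* suc k)) ⟩
    toℚᵘ (+ suc k / 1) ℚᵘ.* toℚᵘ (r (k ℕ.+ a ℕ.* suc k))
      ≈⟨ ℚᵘ.*-cong (toℚᵘ-fromℚᵘ (ℚᵘ.mkℚᵘ (+ suc k) 0)) (rᵘ (k ℕ.+ a ℕ.* suc k)) ⟩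
    ℚᵘ.mkℚᵘ (+ suc k) 0 ℚᵘ.* ℚᵘ.mkℚᵘ (+ 1) (k ℕ.+ a ℕ.* suc k)
      ≈⟨ ℚᵘ.*≡* (cong +_ (eq k a)) ⟩
    ℚᵘ.mkℚᵘ (+ 1) a
      ≈⟨ rᵘ a ⟨
    toℚᵘ (r a) ∎)
    where
    open ≃-Reasoning ℚᵘ.≃-setoid
    eq : ∀ k a → suc k ℕ.* 1 ℕ.* suc a ≡ 1 ℕ.* (1 ℕ.* suc (k ℕ.+ a ℕ.* suc k))
    eq k a = trans (cong (ℕ._* suc a) (ℕ.*-identityʳ (suc k)))
      (trans (ℕ.*-comm (suc k) (suc a))
        (sym (trans (ℕ.*-identityˡ _) (ℕ.*-identityˡ _))))

  archimedean : ∀ e → 0ℚ < e → ∃[ N ] r N ≤ e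
  archimedean e@(mkℚ (+ suc n) d c) _ = d , toℚᵘ-cancel-≤ (begin
    toℚᵘ (r d)               ≃⟨ rᵘ d ⟩
    ℚᵘ.mkℚᵘ (+ 1) d          ≤⟨ ℚᵘ.*≤* (ℤ.*-monoʳ-≤-nonNeg (+ suc d) {+ 1} {+ suc n} (ℤ.+≤+ (s≤s z≤n))) ⟩
    ℚᵘ.mkℚᵘ (+ suc n) d      ∎)
    where open ℚᵘ.≤-Reasoning
  archimedean (mkℚ (+ 0) d c) (*<* (ℤ.+<+ ()))
  archimedean (mkℚ ℤ.-[1+ n ] d c) (*<* ())

  sum-mono : ∀ {f g} → (∀ i → f i ≤ g i) → ∀ n → sum f n ≤ sum g n
  sum-mono f≤g zero    = ≤-refl
  sum-mono f≤g (suc n) = +-mono-≤ (sum-mono f≤g n) (f≤g n)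

  sum-+ : ∀ f a b → sum f (a ℕ.+ b) ≡ sum f a + sum (λ j → f (a ℕ.+ j)) b
  sum-+ f a zero    = trans (cong (sum f) (ℕ.+-identityʳ a)) (sym (+-identityʳ (sum f a)))
  sum-+ f a (suc b) = trans (cong (sum f) (ℕ.+-suc a b))
    (trans (cong (_+ f (a ℕ.+ b)) (sum-+ f a b)) (+-assoc (sum f a) _ _))

  sum-blocks : ∀ f a b → sum f (a ℕ.* b) ≡ sum (λ i → sum (λ j → f (i ℕ.* b ℕ.+ j)) b) a
  sum-blocks f zero    b = refl
  sum-blocks f (suc a) b = trans (cong (sum f) (ℕ.+-comm b (a ℕ.* b)))
    (trans (sum-+ f (a ℕ.* b) b) (cong (_+ sum (λ j → f (a ℕ.* b ℕ.+ j)) b) (sum-blocks f a b)))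

  suc/1 : ∀ b → + suc b / 1 ≡ + b / 1 + 1ℚ
  suc/1 b = toℚᵘ-injective (begin
    toℚᵘ (+ suc b / 1)                     ≈⟨ toℚᵘ-fromℚᵘ (ℚᵘ.mkℚᵘ (+ suc b) 0) ⟩
    ℚᵘ.mkℚᵘ (+ suc b) 0                    ≈⟨ ℚᵘ.*≡* (cong (ℤ._* + 1) eq) ⟩
    ℚᵘ.mkℚᵘ (+ b) 0 ℚᵘ.+ ℚᵘ.1ℚᵘ            ≈⟨ ℚᵘ.+-cong (toℚᵘ-fromℚᵘ (ℚᵘ.mkℚᵘ (+ b) 0)) ℚᵘ.≃-refl ⟨
    toℚᵘ (+ b / 1) ℚᵘ.+ toℚᵘ 1ℚ            ≈⟨ toℚᵘ-homo-+ (+ b / 1) 1ℚ ⟨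
    toℚᵘ (+ b / 1 + 1ℚ)                    ∎)
    where
    open ≃-Reasoning ℚᵘ.≃-setoid
    eq : + suc b ≡ + b ℤ.* + 1 ℤ.+ + 1
    eq = sym (trans (cong (ℤ._+ + 1) (ℤ.*-identityʳ (+ b))) (cong +_ (ℕ.+-comm b 1)))

  suc-* : ∀ b c → (+ suc b / 1) * c ≡ (+ b / 1) * c + c
  suc-* b c = trans (cong (_* c) (suc/1 b))
    (solve 2 (λ b c → (b :+ con 1ℚ) :* c := b :* c :+ c) refl (+ b / 1) c)

  sum-lower : ∀ f c b → (∀ j → j ℕ.< b → c ≤ f j) → (+ b / 1) * c ≤ sum f b
  sum-lower f c zero    h = ≤-reflexive (*-zeroˡ c)
  sum-lower f c (suc b) h = ≤-trans (≤-reflexive (suc-* b c))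
    (+-mono-≤ (sum-lower f c b (λ j j<b → h j (ℕ.m≤n⇒m≤1+n j<b))) (h b ℕ.≤-refl))

  sum-upper : ∀ f c b → (∀ j → j ℕ.< b → f j ≤ c) → sum f b ≤ (+ b / 1) * c
  sum-upper f c zero    h = ≤-reflexive (sym (*-zeroˡ c))
  sum-upper f c (suc b) h = ≤-trans
    (+-mono-≤ (sum-upper f c b (λ j j<b → h j (ℕ.m≤n⇒m≤1+n j<b))) (h b ℕ.≤-refl))
    (≤-reflexive (sym (suc-* b c)))

  -- Right- and left-endpoint sums over N unit intervals.
  lower upper : ℕ → ℕ → ℚ
  lower N m = sum (λ i → r (m ℕ.+ suc i)) (N ℕ.* suc m)
  upper N m = sum (λ i → r (m ℕ.+ i)) (N ℕ.* suc m)

  telescope : ∀ m k → sum (λ i → r (m ℕ.+ i)) k + r (m ℕ.+ k) ≡ sum (λ i → r (m ℕ.+ suc i)) k + r m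
  telescope m zero    = cong (λ z → 0ℚ + r z) (ℕ.+-identityʳ m)
  telescope m (suc k) = begin
    sum (λ i → r (m ℕ.+ i)) k + r (m ℕ.+ k) + r (m ℕ.+ suc k)
      ≡⟨ cong (_+ r (m ℕ.+ suc k)) (telescope m k) ⟩
    sum (λ i → r (m ℕ.+ suc i)) k + r m + r (m ℕ.+ suc k)
      ≡⟨ solve 3 (λ a b c → a :+ b :+ c := a :+ c :+ b) refl
           (sum (λ i → r (m ℕ.+ suc i)) k) (r m) (r (m ℕ.+ suc k)) ⟩
    sum (λ i → r (m ℕ.+ suc i)) k + r (m ℕ.+ suc k) + r m ∎
    where open ≡-Reasoning

  upper≤lower+r : ∀ N m → upper N m ≤ lower N m + r m
  upper≤lower+r N m = begin
    upper N m                              ≡⟨ +-identityʳ (upper N m) ⟨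
    upper N m + 0ℚ                         ≤⟨ +-monoʳ-≤ (upper N m) (0≤r (m ℕ.+ N ℕ.* suc m)) ⟩
    upper N m + r (m ℕ.+ N ℕ.* suc m)      ≡⟨ telescope m (N ℕ.* suc m) ⟩
    lower N m + r m                        ∎
    where open ≤-Reasoning

  lower≤upper : ∀ N m → lower N m ≤ upper N m
  lower≤upper N m = sum-mono (λ i → r-antimono (ℕ.+-monoʳ-≤ m (ℕ.n≤1+n i))) (N ℕ.* suc m)

  refined : ℕ → ℕ → ℕ
  refined m k = k ℕ.+ m ℕ.* suc k

  block-index : ∀ m k i → refined m k ℕ.+ i ℕ.* suc k ≡ k ℕ.+ (m ℕ.+ i) ℕ.* suc k
  block-index m k i = trans (ℕ.+-assoc k (m ℕ.* suc k) (i ℕ.* suc k))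
    (cong (k ℕ.+_) (sym (ℕ.*-distribʳ-+ (suc k) m i)))

  lower-refine : ∀ N m k → lower N m ≤ lower N (refined m k)
  lower-refine N m k = begin
    lower N m
      ≤⟨ sum-mono step (N ℕ.* suc m) ⟩
    sum (λ i → sum (λ j → f (i ℕ.* suc k ℕ.+ j)) (suc k)) (N ℕ.* suc m)
      ≡⟨ sum-blocks f (N ℕ.* suc m) (suc k) ⟨
    sum f (N ℕ.* suc m ℕ.* suc k)
      ≡⟨ cong (sum f) (ℕ.*-assoc N (suc m) (suc k)) ⟩
    lower N (refined m k) ∎
    where
    open ≤-Reasoning
    f : ℕ → ℚ
    f i = r (refined m k ℕ.+ suc i)
    bound : ∀ i j → j ℕ.< suc k →
            refined m k ℕ.+ suc (i ℕ.* suc k ℕ.+ j) ℕ.≤ k ℕ.+ (m ℕ.+ suc i) ℕ.* suc k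
    bound i j (s≤s j≤k) = ℕ.≤-trans
      (ℕ.+-monoʳ-≤ (refined m k) (s≤s (ℕ.≤-trans (ℕ.+-monoʳ-≤ (i ℕ.* suc k) j≤k)
        (ℕ.≤-reflexive (ℕ.+-comm (i ℕ.* suc k) k)))))
      (ℕ.≤-reflexive (block-index m k (suc i)))
    step : ∀ i → r (m ℕ.+ suc i) ≤ sum (λ j → f (i ℕ.* suc k ℕ.+ j)) (suc k)
    step i = ≤-trans (≤-reflexive (sym (r-scale k (m ℕ.+ suc i))))
      (sum-lower _ _ (suc k) (λ j j<k → r-antimono (bound i j j<k)))

  upper-refine : ∀ N m k → upper N (refined m k) ≤ upper N m
  upper-refine N m k = begin
    upper N (refined m k)
      ≡⟨ cong (sum f) (ℕ.*-assoc N (suc m) (suc k)) ⟨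
    sum f (N ℕ.* suc m ℕ.* suc k)
      ≡⟨ sum-blocks f (N ℕ.* suc m) (suc k) ⟩
    sum (λ i → sum (λ j → f (i ℕ.* suc k ℕ.+ j)) (suc k)) (N ℕ.* suc m)
      ≤⟨ sum-mono step (N ℕ.* suc m) ⟩
    upper N m ∎
    where
    open ≤-Reasoning
    f : ℕ → ℚ
    f i = r (refined m k ℕ.+ i)
    bound : ∀ i j → k ℕ.+ (m ℕ.+ i) ℕ.* suc k ℕ.≤ refined m k ℕ.+ (i ℕ.* suc k ℕ.+ j)
    bound i j = ℕ.≤-trans (ℕ.≤-reflexive (sym (block-index m k i)))
      (ℕ.+-monoʳ-≤ (refined m k) (ℕ.m≤m+n (i ℕ.* suc k) j))
    step : ∀ i → sum (λ j → f (i ℕ.* suc k ℕ.+ j)) (suc k) ≤ r (m ℕ.+ i)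
    step i = ≤-trans (sum-upper _ _ (suc k) (λ j _ → r-antimono (bound i j)))
      (≤-reflexive (r-scale k (m ℕ.+ i)))

  lower≤lower+r : ∀ N m k → lower N m ≤ lower N k + r k
  lower≤lower+r N m k = begin
    lower N m               ≤⟨ lower-refine N m k ⟩
    lower N (refined m k)   ≤⟨ lower≤upper N (refined m k) ⟩
    upper N (refined m k)   ≡⟨ cong (upper N) (ℕ.suc-injective (ℕ.*-comm (suc m) (suc k))) ⟩
    upper N (refined k m)   ≤⟨ upper-refine N k m ⟩
    upper N k               ≤⟨ upper≤lower+r N k ⟩
    lower N k + r k         ∎
    where open ≤-Reasoning

  lnSum-cauchy : ∀ n → IsCauchy (lnSum n)
  lnSum-cauchy n e 0<e with archimedean e 0<e
  ... | N , rN≤e = N , λ m k m≥ k≥ → ∣p-q∣-bound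
    (≤-trans (lower≤lower+r (n ℕ.∸ 1) m k) (+-monoʳ-≤ (lnSum n k) (≤-trans (r-antimono k≥) rN≤e)))
    (≤-trans (lower≤lower+r (n ℕ.∸ 1) k m) (+-monoʳ-≤ (lnSum n m) (≤-trans (r-antimono m≥) rN≤e)))

open LnLemmas using (lnSum-cauchy)

-- ln 0 is the junk value 0.
ln : ℕ → ℝ
ln n = mkℝ (lnSum n) (lnSum-cauchy n)

infix 4 _∈o_

_∈o_ : (f g : ℕ → ℝ) → Set
f ∈o g = ∀ c → ι 0ℚ <ᴿ c → ∃[ N ] ∀ x → N ℕ.≤ x → ∣ f x ∣ᴿ ≤ᴿ c *ᴿ ∣ g x ∣ᴿ

-- The item set has n elements and is identified with Fin n.
Itemset : ℕ → Set
Itemset = Subset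

Transactions : ℕ → ℕ → Set
Transactions n m = Vec (Itemset n) m

vectors : ∀ {A : Set} → List A → ∀ n → List (Vec A n)
vectors as zero    = Vec.[] ∷ []
vectors as (suc n) = List.cartesianProductWith Vec._∷_ as (vectors as n)

U : ∀ {n} → ℕ → Pred (Itemset n) 0ℓ
U w x = 1 ℕ.≤ size x × size x ℕ.≤ w

U? : ∀ {n} w → Decidable (U {n} w)
U? w x = (1 ℕ.≤? size x) ×-dec (size x ℕ.≤? w)

listU : ∀ n → ℕ → List (Itemset n)
listU n w = filter (U? w) (vectors (outside ∷ inside ∷ []) n)

module _ {n m : ℕ} .{{_ : ℕ.NonZero m}} (T : Transactions n m) where

  freq : Itemset n → ℚ
  freq x = + count (x ⊆?_) T / m

  decreasing : DecTotalOrder 0ℓ 0ℓ 0ℓ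
  decreasing = On.decTotalOrder (Flip.decTotalOrder ≤-decTotalOrder) freq

  -- Frequency of the K-th itemset (counting from 1) of U in decreasing order of
  -- frequency; the default 0ℚ is used only if U has fewer than K elements.
  kthFreq : ℕ → ℕ → ℚ
  kthFreq K w = maybe′ freq 0ℚ (head (drop (K ℕ.∸ 1) (Sort.sort decreasing (listU n w))))

  TOPK : ℕ → ℕ → Pred (Itemset n × ℝ) 0ℓ
  TOPK K w (x , f) = U w x × kthFreq K w ≤ freq x × f ≃ᴿ ι (freq x)

  record IsApproximation (K w : ℕ) (ε : ℝ) (W : Pred (Itemset n × ℝ) 0ℓ) : Set where
    field
      pairs    : Fin K → Itemset n × ℝ
      pairs∈W  : ∀ i → W (pairs i)
      distinct : ∀ i j → i ≢ j →
                 ¬ (proj₁ (pairs i) ≡ proj₁ (pairs j) × proj₂ (pairs i) ≃ᴿ proj₂ (pairs j))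
      domain   : ∀ x f → W (x , f) → U w x × ι 0ℚ ≤ᴿ f × f ≤ᴿ ι 1ℚ
      P1       : ∀ x f → W (x , f) → ι (kthFreq K w) -ᴿ ε ≤ᴿ ι (freq x)
      P2       : ∀ x → U w x → ¬ (∃[ f ] W (x , f)) → ι (freq x) <ᴿ ι (kthFreq K w) +ᴿ ε
      P3       : ∀ x f → W (x , f) → ∣ f -ᴿ ι (freq x) ∣ᴿ ≤ᴿ ε

-- An outcome records which transaction is drawn at each of the t draws.
Outcome : ℕ → ℕ → Set
Outcome m t = Vec (Fin m) t

sample : ∀ {n m t} → Transactions n m → Outcome m t → Transactions n t
sample D = Vec.map (lookup D)

module _ {m t : ℕ} .{{_ : ℕ.NonZero m}} where

  Pr : {A : Pred (Outcome m t) 0ℓ} → Decidable A → ℚ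
  Pr A? = (+ length (filter A? (vectors (allFin m) t)) / (m ℕ.^ t)) {{ℕ.m^n≢0 m t}}

  -- An event defined by comparing reals need not be decidable, so its
  -- probability is bounded through the decidable events containing it; for a
  -- decidable event this agrees with Pr (see Pr[]<-decidable).
  Pr[_]<_ : Pred (Outcome m t) 0ℓ → ℝ → Set₁
  Pr[ E ]< p = Σ (Pred (Outcome m t) 0ℓ) λ A → Σ (Decidable A) λ A? →
    (∀ s → E s → A s) × ι (Pr A?) <ᴿ p

  Pr-mono : {A B : Pred (Outcome m t) 0ℓ} (A? : Decidable A) (B? : Decidable B) →
            (∀ s → A s → B s) → Pr A? ≤ Pr B?
  Pr-mono A? B? A⇒B = /-monoˡ (m ℕ.^ t) {{ℕ.m^n≢0 m t}}
    (Sublist.length-mono-≤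
      (Sublist.filter⁺ A? B? (λ { {s} refl → A⇒B s }) (Sublist.⊆-refl {x = vectors (allFin m) t})))
    where
    /-monoˡ : ∀ {a b} d .{{_ : ℕ.NonZero d}} → a ℕ.≤ b → + a / d ≤ + b / d
    /-monoˡ {a} {b} (suc k) a≤b = toℚᵘ-cancel-≤ (begin
      toℚᵘ (+ a / suc k)   ≃⟨ toℚᵘ-fromℚᵘ (ℚᵘ.mkℚᵘ (+ a) k) ⟩
      ℚᵘ.mkℚᵘ (+ a) k      ≤⟨ ℚᵘ.*≤* (ℤ.*-monoʳ-≤-nonNeg (+ suc k) {+ a} {+ b} (ℤ.+≤+ a≤b)) ⟩
      ℚᵘ.mkℚᵘ (+ b) k      ≃⟨ toℚᵘ-fromℚᵘ (ℚᵘ.mkℚᵘ (+ b) k) ⟨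
      toℚᵘ (+ b / suc k)   ∎)
      where open ℚᵘ.≤-Reasoning

  Pr[]<-decidable : {E : Pred (Outcome m t) 0ℓ} (E? : Decidable E) {p : ℝ} →
                    Pr[ E ]< p ⇔ ι (Pr E?) <ᴿ p
  Pr[]<-decidable {E} E? = mk⇔
    (λ { (A , A? , E⇒A , e , 0<e , N , h) → e , 0<e , N , λ n n≥ →
           ≤-trans (+-monoˡ-≤ e (Pr-mono E? A? E⇒A)) (h n n≥) })
    (λ h → E , E? , (λ _ e → e) , h)

{-# OPTIONS --safe #-}

-- Take m = 2t + 1 transactions and let every subset of them be the set of
-- occurrences of some item; 2 ^ m ≤ ℓ items suffice, which is available because
-- t ∈ o(ln ℓ).  A sample of size t meets at most t transactions, and the item
-- occurring in exactly those has frequency 1 in the sample but less than 1/2 in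
-- the dataset.  It is in TOPK of the sample and violates P3, so no sample at
-- all yields an ε-approximation.

module Submission where

open import Defs
open import Data.Nat using (ℕ; _+_; _^_; _≤_; suc; NonZero)
open import Data.Nat.Properties using (m^n≢0)
open import Data.Integer using (+_)
open import Data.Rational using (0ℚ; 1ℚ; _/_; _-_)
open import Data.Product using (∃-syntax; Σ-syntax)

open import Data.Empty using (⊥)
open import Data.Bool.Properties using () renaming (_≟_ to _≟ᵇ_)
open import Data.Fin using (Fin; zero; suc; _↑ˡ_; splitAt; finToFun; funToFin)
open import Data.Fin.Properties using (splitAt-↑ˡ; finToFun-funToFin; 2↔Bool)
open import Data.Fin.Subset using (Subset; inside; outside; _∈_; _⊆_; ⁅_⁆)
  renaming (∣_∣ to size; ⊥ to ∅)
open import Data.Fin.Subset.Properties using (_⊆?_; x∈⁅x⁆; x∈⁅y⁆⇒x≡y; ∣⁅x⁆∣≡1; ∣⊥∣≡0)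
import Data.Integer as ℤ
import Data.Integer.Properties as ℤ
import Data.List.Base as List
open import Data.List.Properties using (filter-none)
import Data.List.Relation.Unary.All as All
open import Data.List.Sort using (sort)
open import Data.Maybe.Base using (just; nothing; maybe′)
open import Data.Nat as ℕ using (z≤n; s≤s)
import Data.Nat.Properties as ℕ
open import Data.Product using (_,_)
open import Data.Rational as ℚ using (ℚ; ½)
import Data.Rational.Properties as ℚ
open import Data.Rational.Solver using (module +-*-Solver)
import Data.Rational.Unnormalised as ℚᵘ
import Data.Rational.Unnormalised.Properties as ℚᵘ
open import Data.Sum using ([_,_]′)
open import Data.Vec as Vec using (Vec; []; _∷_; count; lookup; tabulate; _[_]≔_)
open import Data.Vec.Properties
  using (count≤n; lookup-map; lookup∘tabulate; tabulate∘lookup; tabulate-cong;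
         []=⇒lookup; lookup⇒[]=; []≔-updates)
open import Function using (_∘_; const; id; Inverse)
open import Level using (0ℓ)
open import Relation.Binary.PropositionalEquality
open import Relation.Nullary using (¬_; yes; no; contradiction)
open import Relation.Nullary.Decidable using (from-no; from-yes)
open import Relation.Unary using (Pred; Decidable)

open LnLemmas using (r; 0≤r; r-scale; r-antimono; sum-+; sum-upper; suc/1)
open RealLemmas using (q≤∣q∣)

-- Order and addition of fractions

/-mono : ∀ a b c d .{{_ : NonZero b}} .{{_ : NonZero d}} →
         a ℕ.* d ≤ c ℕ.* b → + a / b ℚ.≤ + c / d
/-mono a (suc b) c (suc d) ad≤cb = ℚ.toℚᵘ-cancel-≤ (begin
  ℚ.toℚᵘ (+ a / suc b)   ≃⟨ ℚ.toℚᵘ-fromℚᵘ (ℚᵘ.mkℚᵘ (+ a) b) ⟩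
  ℚᵘ.mkℚᵘ (+ a) b        ≤⟨ ℚᵘ.*≤* (subst₂ ℤ._≤_ (ℤ.pos-* a (suc d)) (ℤ.pos-* c (suc b))
                                   (ℤ.+≤+ ad≤cb)) ⟩
  ℚᵘ.mkℚᵘ (+ c) d        ≃⟨ ℚ.toℚᵘ-fromℚᵘ (ℚᵘ.mkℚᵘ (+ c) d) ⟨
  ℚ.toℚᵘ (+ c / suc d)   ∎)
  where open ℚᵘ.≤-Reasoning

+/1 : ∀ a b → + (a + b) / 1 ≡ + a / 1 ℚ.+ + b / 1
+/1 ℕ.zero  b = sym (ℚ.+-identityˡ _)
+/1 (suc a) b = begin
  + suc (a + b) / 1               ≡⟨ suc/1 (a + b) ⟩
  + (a + b) / 1 ℚ.+ 1ℚ            ≡⟨ cong (ℚ._+ 1ℚ) (+/1 a b) ⟩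
  + a / 1 ℚ.+ + b / 1 ℚ.+ 1ℚ      ≡⟨ solve 2 (λ x y → x :+ y :+ con 1ℚ := x :+ con 1ℚ :+ y) refl
                                           (+ a / 1) (+ b / 1) ⟩
  + a / 1 ℚ.+ 1ℚ ℚ.+ + b / 1      ≡⟨ cong (ℚ._+ + b / 1) (suc/1 a) ⟨
  + suc a / 1 ℚ.+ + b / 1         ∎
  where
  open ≡-Reasoning
  open +-*-Solver

-- Growth of the logarithm

sum-monoˡ : ∀ {f} → (∀ i → 0ℚ ℚ.≤ f i) → ∀ {a b} → a ≤ b → sum f a ℚ.≤ sum f b
sum-monoˡ {f} 0≤f = go ∘ ℕ.≤⇒≤′
  where
  go : ∀ {a b} → a ℕ.≤′ b → sum f a ℚ.≤ sum f b
  go ℕ.≤′-refl                = ℚ.≤-refl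
  go {b = suc b} (ℕ.≤′-step p) = ℚ.≤-trans (go p)
    (ℚ.≤-trans (ℚ.≤-reflexive (sym (ℚ.+-identityʳ _))) (ℚ.+-monoʳ-≤ (sum f b) (0≤f b)))

lnSum-mono : ∀ m {a b} → a ≤ b → lnSum a m ℚ.≤ lnSum b m
lnSum-mono m a≤b = sum-monoˡ (λ i → 0≤r (m + suc i)) (ℕ.*-monoˡ-≤ (suc m) (ℕ.∸-monoˡ-≤ 1 a≤b))

0≤lnSum : ∀ n m → 0ℚ ℚ.≤ lnSum n m
0≤lnSum n m = lnSum-mono m {0} {n} z≤n

-- The added terms number n (m + 1), and each is at most 1 / (n (m + 1)).
lnSum-double : ∀ n m .{{_ : NonZero n}} → lnSum (2 ℕ.* n) m ℚ.≤ lnSum n m ℚ.+ 1ℚ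
lnSum-double (suc n) m = begin
  lnSum (2 ℕ.* suc n) m
    ≡⟨ cong (sum f) splitting ⟩
  sum f (a + suc k)
    ≡⟨ sum-+ f a (suc k) ⟩
  lnSum (suc n) m ℚ.+ sum (λ j → f (a + j)) (suc k)
    ≤⟨ ℚ.+-monoʳ-≤ (lnSum (suc n) m) (sum-upper _ (r k) (suc k) (λ j _ → r-antimono (bound j))) ⟩
  lnSum (suc n) m ℚ.+ (+ suc k / 1) ℚ.* r k
    ≡⟨ cong (λ i → lnSum (suc n) m ℚ.+ (+ suc k / 1) ℚ.* r i) (ℕ.+-identityʳ k) ⟨
  lnSum (suc n) m ℚ.+ (+ suc k / 1) ℚ.* r (k + 0)
    ≡⟨ cong (lnSum (suc n) m ℚ.+_) (r-scale k 0) ⟩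
  lnSum (suc n) m ℚ.+ 1ℚ ∎
  where
  open ℚ.≤-Reasoning
  f : ℕ → ℚ
  f i = r (m + suc i)
  a = n ℕ.* suc m
  k = m + a
  -- Here `suc k` is the unfolded form of `suc n * suc m`, the number of mesh cells between n + 1
  -- and 2(n + 1).
  splitting : (2 ℕ.* suc n ℕ.∸ 1) ℕ.* suc m ≡ a + suc k
  splitting = trans (ℕ.*-distribʳ-+ (suc m) n (suc n + 0))
    (cong (λ i → a + i ℕ.* suc m) (ℕ.+-identityʳ (suc n)))
  bound : ∀ j → k ≤ m + suc (a + j)
  bound j = ℕ.+-monoʳ-≤ m (ℕ.m≤n⇒m≤1+n (ℕ.m≤m+n a j))

-- The sum at `2 ^ 0` is empty and each doubling adds at most 1. The crude estimate ln 2 ≤ 1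
-- suffices later, and it holds at every mesh `m`, so no limit has to be taken.
lnSum-2^ : ∀ k m → lnSum (2 ^ k) m ℚ.≤ + k / 1
lnSum-2^ ℕ.zero  m = ℚ.≤-refl
lnSum-2^ (suc k) m = begin
  lnSum (2 ^ suc k) m      ≤⟨ lnSum-double (2 ^ k) m {{m^n≢0 2 k}} ⟩
  lnSum (2 ^ k) m ℚ.+ 1ℚ   ≤⟨ ℚ.+-monoˡ-≤ 1ℚ (lnSum-2^ k m) ⟩
  + k / 1 ℚ.+ 1ℚ           ≡⟨ suc/1 k ⟨
  + suc k / 1              ∎
  where open ℚ.≤-Reasoning

-- If ℓ were smaller, `lnSum ℓ m` would be at most 2t + 1. The hypothesis then gives t ≤ (2t + 1)/4
-- + 1/8 = t/2 + 3/8, so t/2 ≤ 3/8, which fails for t ≥ 1. The constants 1/4 and 1/8 are chosen so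
-- that this remainder stays below 1/2.
2^[2t+1]≤ℓ : ∀ t ℓ m .{{_ : NonZero t}} →
             + t / 1 ℚ.≤ (+ 1 / 4) ℚ.* lnSum ℓ m ℚ.+ (+ 1 / 8) → 2 ^ suc (t + t) ≤ ℓ
2^[2t+1]≤ℓ t ℓ m t≤ with 2 ^ suc (t + t) ℕ.≤? ℓ
... | yes 2^≤ℓ = 2^≤ℓ
... | no  2^≰ℓ = contradiction ½≤⅜ (from-no (½ ℚ.≤? (+ 3 / 8)))
  where
  open ℚ.≤-Reasoning
  open +-*-Solver
  q = + t / 1
  lnSum≤ : lnSum ℓ m ℚ.≤ q ℚ.+ q ℚ.+ 1ℚ
  lnSum≤ = begin
    lnSum ℓ m                   ≤⟨ lnSum-mono m (ℕ.<⇒≤ (ℕ.≰⇒> 2^≰ℓ)) ⟩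
    lnSum (2 ^ suc (t + t)) m   ≤⟨ lnSum-2^ (suc (t + t)) m ⟩
    + suc (t + t) / 1           ≡⟨ suc/1 (t + t) ⟩
    + (t + t) / 1 ℚ.+ 1ℚ        ≡⟨ cong (ℚ._+ 1ℚ) (+/1 t t) ⟩
    q ℚ.+ q ℚ.+ 1ℚ              ∎
  ½≤⅜ : ½ ℚ.≤ + 3 / 8
  ½≤⅜ = begin
    ½ ℚ.* 1ℚ
      ≤⟨ ℚ.*-monoˡ-≤-nonNeg ½ (/-mono 1 1 t 1 (ℕ.*-monoˡ-≤ 1 (ℕ.>-nonZero⁻¹ t))) ⟩
    ½ ℚ.* q
      ≡⟨ solve 1 (λ q → con ½ :* q := q :- con ½ :* q) refl q ⟩
    q - ½ ℚ.* q
      ≤⟨ ℚ.+-monoˡ-≤ (ℚ.- (½ ℚ.* q)) t≤ ⟩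
    (+ 1 / 4) ℚ.* lnSum ℓ m ℚ.+ (+ 1 / 8) - ½ ℚ.* q
      ≤⟨ ℚ.+-monoˡ-≤ (ℚ.- (½ ℚ.* q)) (ℚ.+-monoˡ-≤ (+ 1 / 8) (ℚ.*-monoˡ-≤-nonNeg (+ 1 / 4) lnSum≤)) ⟩
    (+ 1 / 4) ℚ.* (q ℚ.+ q ℚ.+ 1ℚ) ℚ.+ (+ 1 / 8) - ½ ℚ.* q
      ≡⟨ solve 1 (λ q → con (+ 1 / 4) :* (q :+ q :+ con 1ℚ) :+ con (+ 1 / 8) :- con ½ :* q
                     := con (+ 3 / 8)) refl q ⟩
    + 3 / 8 ∎

-- Counts and frequencies

module _ {A B : Set} {P : Pred A 0ℓ} {Q : Pred B 0ℓ} (P? : Decidable P) (Q? : Decidable Q) where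

  count-mono : ∀ {n} (xs : Vec A n) (ys : Vec B n) →
               (∀ i → P (lookup xs i) → Q (lookup ys i)) → count P? xs ≤ count Q? ys
  count-mono []       []       P⇒Q = z≤n
  count-mono (x ∷ xs) (y ∷ ys) P⇒Q with P? x | Q? y
  ... | yes p | yes q = s≤s (count-mono xs ys (P⇒Q ∘ suc))
  ... | yes p | no ¬q = contradiction (P⇒Q zero p) ¬q
  ... | no ¬p | yes q = ℕ.m≤n⇒m≤1+n (count-mono xs ys (P⇒Q ∘ suc))
  ... | no ¬p | no ¬q = count-mono xs ys (P⇒Q ∘ suc)

count-all : ∀ {A : Set} {P : Pred A 0ℓ} (P? : Decidable P) {n} (xs : Vec A n) →
            (∀ i → P (lookup xs i)) → count P? xs ≡ n
count-all P? []       all = refl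
count-all P? (x ∷ xs) all with P? x
... | yes p = cong suc (count-all P? xs (all ∘ suc))
... | no ¬p = contradiction (all zero) ¬p

module _ {n m : ℕ} .{{_ : NonZero m}} (T : Transactions n m) where

  freq≤1 : ∀ x → freq T x ℚ.≤ 1ℚ
  freq≤1 x = /-mono (count (x ⊆?_) T) m 1 1
    (subst₂ _≤_ (sym (ℕ.*-identityʳ _)) (sym (ℕ.*-identityˡ m)) (count≤n (x ⊆?_) T))

  -- The threshold is either some frequency or the default 0. Hence an itemset of sample frequency 1
  -- enters `TOPK` without any analysis of the sort or of ties.
  kthFreq≤1 : ∀ K w → kthFreq T K w ℚ.≤ 1ℚ
  kthFreq≤1 K w = default (List.head (List.drop (K ℕ.∸ 1) (sort (decreasing T) (listU n w))))
    where
    default : ∀ x? → maybe′ (freq T) 0ℚ x? ℚ.≤ 1ℚ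
    default (just x) = freq≤1 x
    default nothing  = from-yes (0ℚ ℚ.≤? 1ℚ)

  freq-everywhere : ∀ x → (∀ i → x ⊆ lookup T i) → 1ℚ ℚ.≤ freq T x
  freq-everywhere x all = /-mono 1 1 (count (x ⊆?_) T) m (ℕ.≤-reflexive
    (trans (ℕ.*-identityˡ m) (sym (trans (ℕ.*-identityʳ _) (count-all (x ⊆?_) T all)))))

-- Singletons and the set of transactions met by a sample

∈⇒⁅⁆⊆ : ∀ {n} {z : Fin n} {p} → z ∈ p → ⁅ z ⁆ ⊆ p
∈⇒⁅⁆⊆ {z = z} {p} z∈p y∈ = subst (_∈ p) (sym (x∈⁅y⁆⇒x≡y z y∈)) z∈p

size-[]≔ : ∀ {n} (p : Subset n) i → size (p [ i ]≔ inside) ≤ suc (size p)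
size-[]≔ (outside ∷ p) zero    = ℕ.≤-refl
size-[]≔ (inside  ∷ p) zero    = ℕ.n≤1+n _
size-[]≔ (outside ∷ p) (suc i) = size-[]≔ p i
size-[]≔ (inside  ∷ p) (suc i) = s≤s (size-[]≔ p i)

range : ∀ {m t} → Outcome m t → Subset m
range []      = ∅
range (i ∷ s) = range s [ i ]≔ inside

size-range : ∀ {m t} (s : Outcome m t) → size (range s) ≤ t
size-range {m} []      = ℕ.≤-reflexive (∣⊥∣≡0 m)
size-range     (i ∷ s) = ℕ.≤-trans (size-[]≔ (range s) i) (s≤s (size-range s))

[]≔-inside : ∀ {n} (p : Subset n) i {j} → lookup p j ≡ inside → lookup (p [ i ]≔ inside) j ≡ inside
[]≔-inside (_ ∷ p) zero    {zero}  _ = refl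
[]≔-inside (_ ∷ p) zero    {suc j} h = h
[]≔-inside (_ ∷ p) (suc i) {zero}  h = h
[]≔-inside (_ ∷ p) (suc i) {suc j} h = []≔-inside p i h

lookup-range : ∀ {m t} (s : Outcome m t) j → lookup (range s) (lookup s j) ≡ inside
lookup-range (i ∷ s) zero    = []=⇒lookup ([]≔-updates (range s) i)
lookup-range (i ∷ s) (suc j) = []≔-inside (range s) i (lookup-range s j)

-- A dataset that realises every set of occurrences

-- The first `2 ^ m` indices are read as strings of m bits, which reach every subset; the remaining
-- `d` indices go to the empty set.
enumerateSubsets : ∀ m {n} → 2 ^ m ≤ n → Σ[ g ∈ (Fin n → Subset m) ] ∀ p → ∃[ z ] g z ≡ p
enumerateSubsets m 2^m≤n with ℕ.m≤n⇒∃[o]m+o≡n 2^m≤n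
... | d , refl = g , λ p → encode p ↑ˡ d , (begin
    g (encode p ↑ˡ d)          ≡⟨ cong [ decode , const ∅ ]′ (splitAt-↑ˡ (2 ^ m) (encode p) d) ⟩
    decode (encode p)          ≡⟨ tabulate-cong (λ i → trans
                                    (cong (Inverse.to 2↔Bool) (finToFun-funToFin _ i))
                                    (Inverse.strictlyInverseˡ 2↔Bool (lookup p i))) ⟩
    tabulate (lookup p)        ≡⟨ tabulate∘lookup p ⟩
    p                          ∎)
  where
  open ≡-Reasoning
  decode : Fin (2 ^ m) → Subset m
  decode k = tabulate (Inverse.to 2↔Bool ∘ finToFun k)
  encode : Subset m → Fin (2 ^ m)
  encode p = funToFin (Inverse.from 2↔Bool ∘ lookup p)
  g : Fin (2 ^ m + d) → Subset m
  g z = [ decode , const ∅ ]′ (splitAt (2 ^ m) z)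

-- The dataset in which item z occurs exactly in the transactions of g z.
dataset : ∀ {n m} → (Fin n → Subset m) → Transactions n m
dataset g = tabulate (λ i → tabulate (λ z → lookup (g z) i))

module _ {n m : ℕ} (g : Fin n → Subset m) where

  lookup-dataset : ∀ i z → lookup (lookup (dataset g) i) z ≡ lookup (g z) i
  lookup-dataset i z = trans (cong (λ p → lookup p z) (lookup∘tabulate _ i)) (lookup∘tabulate _ z)

  count-dataset : ∀ z → count (⁅ z ⁆ ⊆?_) (dataset g) ≤ size (g z)
  -- `size` is itself a count of `inside` entries, so the two counts can be compared position by
  -- position.
  count-dataset z = count-mono (⁅ z ⁆ ⊆?_) (_≟ᵇ inside) (dataset g) (g z)
    (λ i z⊆ → trans (sym (lookup-dataset i z)) ([]=⇒lookup (z⊆ (x∈⁅x⁆ z))))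

  freq-dataset : ∀ z t .{{_ : NonZero m}} → size (g z) ≤ t → t + t ≤ m → freq (dataset g) ⁅ z ⁆ ℚ.≤ ½
  freq-dataset z t size≤t 2t≤m = /-mono (count (⁅ z ⁆ ⊆?_) (dataset g)) m 1 2 (begin
    count (⁅ z ⁆ ⊆?_) (dataset g) ℕ.* 2   ≤⟨ ℕ.*-monoˡ-≤ 2 (ℕ.≤-trans (count-dataset z) size≤t) ⟩
    t ℕ.* 2                               ≡⟨ ℕ.*-comm t 2 ⟩
    t + (t + 0)                           ≡⟨ cong (λ i → t + i) (ℕ.+-identityʳ t) ⟩
    t + t                                 ≤⟨ 2t≤m ⟩
    m                                     ≡⟨ ℕ.*-identityˡ m ⟨
    1 ℕ.* m                               ∎)
    where open ℕ.≤-Reasoning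

  -- Every draw lands in `range s`, which is exactly where item `z` occurs.
  ⊆-sample : ∀ {t} (s : Outcome m t) z → g z ≡ range s → ∀ j → ⁅ z ⁆ ⊆ lookup (sample (dataset g) s) j
  ⊆-sample s z gz≡ j = ∈⇒⁅⁆⊆ (lookup⇒[]= z _ (begin
    lookup (lookup (sample (dataset g) s) j) z   ≡⟨ cong (λ p → lookup p z) (lookup-map j _ s) ⟩
    lookup (lookup (dataset g) (lookup s j)) z   ≡⟨ lookup-dataset (lookup s j) z ⟩
    lookup (g z) (lookup s j)                    ≡⟨ cong (λ p → lookup p (lookup s j)) gz≡ ⟩
    lookup (range s) (lookup s j)                ≡⟨ lookup-range s j ⟩
    inside                                       ∎))
    where open ≡-Reasoning

-- Failure of the approximation and its probability

module _ {n m t : ℕ} .{{_ : NonZero m}} .{{_ : NonZero t}}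
         (D : Transactions n m) (S : Transactions n t) (K w : ℕ) where

  -- The pair of `x` with its sample frequency lies in `TOPK`, and `P3` would bound a gap of at
  -- least 1/2 by `ε`, which is below 1/4.
  overestimate⇒¬approximation : ∀ ε → ε <ᴿ ι (+ 1 / 4) → ∀ x → U w x → 1ℚ ℚ.≤ freq S x → freq D x ℚ.≤ ½ →
                                ¬ IsApproximation D K w ε (TOPK S K w)
  overestimate⇒¬approximation ε (e , 0<e , N , ε+e≤¼) x Ux 1≤ ≤½ approx with
    IsApproximation.P3 approx x (ι (freq S x))
      (Ux , ℚ.≤-trans (kthFreq≤1 S K w) 1≤ , λ e 0<e → 0 , λ _ _ →
        subst (ℚ._≤ e) (sym (cong ℚ.∣_∣ (ℚ.+-inverseʳ (freq S x)))) (ℚ.<⇒≤ 0<e))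
      -- The slack in `P3` is set to the gap `e` between `ε` and 1/4, so that `ε` plus the slack is
      -- eventually at most 1/4.
      e 0<e
  ... | N′ , close = contradiction (begin
    1ℚ - ½                           ≤⟨ ℚ.+-mono-≤ 1≤ (ℚ.neg-antimono-≤ ≤½) ⟩
    freq S x - freq D x              ≤⟨ q≤∣q∣ _ ⟩
    ℚ.∣ freq S x - freq D x ∣        ≤⟨ close k (ℕ.m≤n⊔m N N′) ⟩
    seq ε k ℚ.+ e                    ≤⟨ ε+e≤¼ k (ℕ.m≤m⊔n N N′) ⟩
    + 1 / 4                          ∎) (from-no ((1ℚ - ½) ℚ.≤? (+ 1 / 4)))
    where
    open ℚ.≤-Reasoning
    k = N ℕ.⊔ N′

-- `E` need not come with a decision procedure: the decidable event that covers it is the empty one,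
-- whose probability is 0.
Pr-impossible : ∀ {m t} .{{_ : NonZero m}} {E : Pred (Outcome m t) 0ℓ} {p : ℝ} →
                (∀ s → ¬ E s) → ι 0ℚ <ᴿ p → Pr[ E ]< p
Pr-impossible {m} {t} {p = p} ¬E 0<p = (λ _ → ⊥) , never , ¬E , subst (λ q → ι q <ᴿ p) (sym Pr≡0) 0<p
  where
  never : Decidable {A = Outcome m t} (λ _ → ⊥)
  never _ = no id
  Pr≡0 : Pr never ≡ 0ℚ
  Pr≡0 = trans
    (cong (λ l → (+ List.length l / (m ^ t)) {{m^n≢0 m t}})
      (filter-none never (All.universal (λ _ → id) (vectors (List.allFin m) t))))
    (ℚ.0/n≡0 (m ^ t) {{m^n≢0 m t}})

-- The counterexample for all large ℓ

theorem2 : (K w : ℕ) → 1 ≤ K → 1 ≤ w →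
    (ε : ℝ) → ι 0ℚ <ᴿ ε → ε <ᴿ ι (+ 1 / 4) →
    (δ : ℝ) → δ <ᴿ ι (1ℚ - (+ 1 / (2 ^ K)) {{m^n≢0 2 K}}) →
    (t : ℕ → ℕ) (t>0 : ∀ x → NonZero (t x)) → (λ x → ℕ→ℝ (t x)) ∈o ln →
    ∃[ L ] ∀ ℓ → L ≤ ℓ →
    ∃[ m ] Σ[ D ∈ Transactions (K + ℓ) (suc m) ]
    Pr[ (λ (s : Outcome (suc m) (t ℓ)) → IsApproximation D K w ε (TOPK {{t>0 ℓ}} (sample D s) K w)) ]<
    (ι 1ℚ -ᴿ δ)
theorem2 K w 1≤K 1≤w ε 0<ε ε<¼ δ (e , 0<e , N , δ+e≤) t t>0 t∈o
  -- The factor 1/4 is the one that `2^[2t+1]≤ℓ` expects.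
  with t∈o (ι (+ 1 / 4)) (+ 1 / 4 , from-yes (0ℚ ℚ.<? (+ 1 / 4)) , 0 , λ _ _ → ℚ.≤-refl)
... | L , t≤ln = L , counterexample
  where
  -- Eventually `δ` stays `e` below 1 - 2⁻ᴷ, hence `e` below 1, so the same `e` witnesses
  -- positivity.
  0<1-δ : ι 0ℚ <ᴿ ι 1ℚ -ᴿ δ
  0<1-δ = e , 0<e , N , λ n N≤n → begin
    0ℚ ℚ.+ e                  ≡⟨ solve 2 (λ d e → con 0ℚ :+ e := d :+ e :- d) refl (seq δ n) e ⟩
    seq δ n ℚ.+ e - seq δ n   ≤⟨ ℚ.+-monoˡ-≤ (ℚ.- seq δ n) (ℚ.≤-trans (δ+e≤ n N≤n) 1-2⁻ᴷ≤1) ⟩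
    1ℚ - seq δ n              ∎
    where
    open ℚ.≤-Reasoning
    open +-*-Solver
    2⁻ᴷ = (+ 1 / (2 ^ K)) {{m^n≢0 2 K}}
    1-2⁻ᴷ≤1 : 1ℚ - 2⁻ᴷ ℚ.≤ 1ℚ
    1-2⁻ᴷ≤1 = ℚ.+-monoʳ-≤ 1ℚ (ℚ.neg-antimono-≤ (/-mono 0 1 1 (2 ^ K) {{_}} {{m^n≢0 2 K}} z≤n))

  counterexample : ∀ ℓ → L ≤ ℓ →
    ∃[ m ] Σ[ D ∈ Transactions (K + ℓ) (suc m) ]
    Pr[ (λ (s : Outcome (suc m) (t ℓ)) → IsApproximation D K w ε (TOPK {{t>0 ℓ}} (sample D s) K w)) ]<
    (ι 1ℚ -ᴿ δ)
  counterexample ℓ L≤ℓ with t≤ln ℓ L≤ℓ (+ 1 / 8) (from-yes (0ℚ ℚ.<? (+ 1 / 8)))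
  ... | M , t≤ with enumerateSubsets (suc (t ℓ + t ℓ)) {K + ℓ} (ℕ.≤-trans enough (ℕ.m≤n+m ℓ K))
    where
    enough : 2 ^ suc (t ℓ + t ℓ) ≤ ℓ
    -- The absolute values from `_∈o_` disappear because t is at most its absolute value and `lnSum`
    -- is nonnegative. The single index `M` is enough.
    enough = 2^[2t+1]≤ℓ (t ℓ) ℓ M {{t>0 ℓ}} (ℚ.≤-trans (q≤∣q∣ _)
      (subst (λ q → ℚ.∣ + t ℓ / 1 ∣ ℚ.≤ (+ 1 / 4) ℚ.* q ℚ.+ (+ 1 / 8))
        (ℚ.0≤p⇒∣p∣≡p (0≤lnSum ℓ M)) (t≤ M ℕ.≤-refl)))
  -- The witness is 2t because the dataset has one transaction more, which keeps it nonempty. An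
  -- item found in at most t of these 2t + 1 transactions has frequency at most 1/2.
  ... | g , surjective = t ℓ + t ℓ , dataset g , Pr-impossible {p = ι 1ℚ -ᴿ δ} never 0<1-δ
    where
    never : ∀ (s : Outcome (suc (t ℓ + t ℓ)) (t ℓ)) →
            ¬ IsApproximation (dataset g) K w ε (TOPK {{t>0 ℓ}} (sample (dataset g) s) K w)
    never s with surjective (range s)
    ... | z , gz≡ = overestimate⇒¬approximation {{_}} {{t>0 ℓ}}
      (dataset g) (sample (dataset g) s) K w ε ε<¼ ⁅ z ⁆
      (ℕ.≤-reflexive (sym (∣⁅x⁆∣≡1 z)) , subst (_≤ w) (sym (∣⁅x⁆∣≡1 z)) 1≤w)
      (freq-everywhere {{t>0 ℓ}} (sample (dataset g) s) ⁅ z ⁆ (⊆-sample g s z gz≡))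
      (freq-dataset g z (t ℓ) (subst (λ p → size p ≤ t ℓ) (sym gz≡) (size-range s)) (ℕ.n≤1+n _))
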